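{- Let $d\le n$ be nonnegative integers and let $\mathcal P_d$ be the linear operator on functions $f:\{\pm1\}^n\to\mathbb R$ mapping $f=\sum_{\alpha\subseteq[n]}\hat f_\alpha\chi_\alpha$ to its low-degree part $\sum_{|\alpha|\le d}\hat f_\alpha\chi_\alpha$, where $\chi_\alpha(x)=\prod_{i\in\alpha}x_i$. Then $\textsf{Tensor-SDP}(\mathcal P_d)\le 9^d$.
   Context: A level-$r$ pseudo-expectation functional on polynomials in variables $y_1,\dots,y_N$ is a map $\tilde{\mathbb E}$ from real polynomials of degree at most $r$ to $\mathbb R$ that is linear, satisfies $\tilde{\mathbb E}[1]=1$, and satisfies $\tilde{\mathbb E}[P^2]\ge 0$ for every polynomial $P$ of degree at most $r/2$. For a linear operator $A$ from functions on a finite set $\mathcal U$ to functions on a finite set $\mathcal V$, $\textsf{Tensor-SDP}^{(r)}(A)$ is the maximum of $\tilde{\mathbb E}_f\|Af\|_4^4$ over level-$r$ pseudo-expectation functionals $\tilde{\mathbb E}$ on polynomials in the variables $\{f(u)\}_{u\in\mathcal U}$ satisfying $\tilde{\mathbb E}_f(\|f\|_2^2-1)^2=0$; here $\|g\|_p=(\mathbb E_{v}|g(v)|^p)^{1/p}$ is the expectation norm (uniform average), so $\|Af\|_4^4$ and $\|f\|_2^2$ are polynomials in the variables $f(u)$. $\textsf{Tensor-SDP}$ denotes $\textsf{Tensor-SDP}^{(4)}$. Expectations over $\{\pm1\}^n$ are with respect to the uniform distribution. -}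

module Defs where

open import Algebra.Bundles using (CommutativeRing; Semiring)
open import Algebra.Apartness.Structures using (IsHeytingField)
import Algebra.Definitions.RawMonoid as RawMonoidDefs
import Algebra.Definitions.RawSemiring as RawSemiringDefs
import Algebra.Properties.AbelianGroup as AbelianGroupProperties
import Algebra.Properties.Ring as RingProperties
open import Data.Fin.Subset using (Subset; inside; outside; ∣_∣)
open import Data.List.Base using (List; []; _∷_; foldr; length; filter; cartesianProductWith)
open import Data.List.Membership.Propositional using (_∈_)
open import Data.List.Membership.Propositional.Properties using (∈-cartesianProductWith⁺)
open import Data.List.Relation.Unary.All using ([]; _∷_)
open import Data.List.Relation.Unary.Any using (here; there)
open import Data.List.Relation.Unary.AllPairs using ([]; _∷_)
open import Data.List.Relation.Unary.Unique.Propositional using (Unique)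
open import Data.List.Relation.Unary.Unique.Propositional.Properties using (cartesianProductWith⁺)
open import Data.Nat.Base as ℕ using (ℕ; zero; suc; z≤n)
open import Data.Nat.Properties as ℕₚ using (_≤?_)
open import Data.Product.Base using (∃-syntax; _,_; proj₁; _×_)
open import Data.Sign.Base as Sign using (Sign)
import Data.Sign.Properties as Signₚ
open import Data.Sum.Base using (_⊎_; inj₁; inj₂)
open import Data.Vec.Base using (Vec; []; _∷_)
open import Data.Vec.Properties using (∷-injective; ≡-dec)
open import Level using (_⊔_) renaming (suc to lsuc)
open import Relation.Binary.Core using (Rel)
open import Relation.Binary.Definitions using (DecidableEquality)
open import Relation.Binary.PropositionalEquality.Core using (refl)
open import Relation.Binary.Structures using (IsStrictPartialOrder)
open import Relation.Nullary.Negation using (¬_)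
open import Relation.Nullary.Decidable using (yes; no)

-- The real numbers are given axiomatically, as a Cauchy-complete Archimedean
-- ordered field; classically these axioms determine ℝ up to isomorphism.  The
-- order is not assumed decidable, so constructive models are admitted as well.

record Reals c ℓ₁ ℓ₂ : Set (lsuc (c ⊔ ℓ₁ ⊔ ℓ₂)) where
  infix  4 _≈_ _<_ _≤_ _#_
  infixl 6 _+_
  infixl 7 _*_
  infix  8 -_
  field
    Carrier : Set c
    _≈_     : Rel Carrier ℓ₁
    _<_     : Rel Carrier ℓ₂
    _+_ _*_ : Carrier → Carrier → Carrier
    -_      : Carrier → Carrier
    0# 1#   : Carrier

  _#_ : Rel Carrier ℓ₂
  x # y = x < y ⊎ y < x

  _≤_ : Rel Carrier ℓ₂
  x ≤ y = ¬ (y < x)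

  field
    isHeytingField       : IsHeytingField _≈_ _#_ _+_ _*_ -_ 0# 1#
    isStrictPartialOrder : IsStrictPartialOrder _≈_ _<_
    +-monoˡ-<            : ∀ {x y} z → x < y → x + z < y + z
    *-pos                : ∀ {x y} → 0# < x → 0# < y → 0# < x * y

  open IsHeytingField isHeytingField public
    using (isCommutativeRing; #⇒invertible; invertible⇒#)

  commutativeRing : CommutativeRing c ℓ₁
  commutativeRing = record { isCommutativeRing = isCommutativeRing }

  open CommutativeRing commutativeRing using (+-rawMonoid; _-_)
  open RawMonoidDefs +-rawMonoid using () renaming (_×_ to _·_)

  fromℕ : ℕ → Carrier
  fromℕ n = n · 1#

  -- No absolute values are needed in IsCauchy: m and n may be exchanged.
  IsCauchy : (ℕ → Carrier) → Set ℓ₂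
  IsCauchy s = ∀ k → ∃[ N ] ∀ m n → N ℕ.≤ m → N ℕ.≤ n →
               fromℕ (suc k) * (s m - s n) < 1#

  _ConvergesTo_ : (ℕ → Carrier) → Carrier → Set ℓ₂
  s ConvergesTo l = ∀ k → ∃[ N ] ∀ n → N ℕ.≤ n →
                    fromℕ (suc k) * (s n - l) < 1# × fromℕ (suc k) * (l - s n) < 1#

  field
    archimedean : ∀ x → ∃[ n ] x < fromℕ n
    complete    : ∀ s → IsCauchy s → ∃[ l ] s ConvergesTo l

-- The expectation norms are averages, so finite sets are taken to be nonempty.

record FiniteSet : Set₁ where
  field
    Element  : Set
    _≟_      : DecidableEquality Element
    elements : List Element
    complete : ∀ x → x ∈ elements
    unique   : Unique elements
    nonEmpty : ℕ.NonZero (length elements)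

open FiniteSet using (Element; elements)

allVecs : ∀ {A : Set} → List A → ∀ n → List (Vec A n)
allVecs xs zero    = [] ∷ []
allVecs xs (suc n) = cartesianProductWith _∷_ xs (allVecs xs n)

allVecs-complete : ∀ {A : Set} {xs : List A} → (∀ x → x ∈ xs) →
                   ∀ {n} (v : Vec A n) → v ∈ allVecs xs n
allVecs-complete ∈xs []      = here refl
allVecs-complete ∈xs (x ∷ v) =
  ∈-cartesianProductWith⁺ _∷_ (∈xs x) (allVecs-complete ∈xs v)

allVecs-unique : ∀ {A : Set} {xs : List A} → Unique xs → ∀ n → Unique (allVecs xs n)
allVecs-unique uniq zero    = [] ∷ []
allVecs-unique uniq (suc n) =
  cartesianProductWith⁺ _∷_ ∷-injective uniq (allVecs-unique uniq n)

∈⇒nonEmpty : ∀ {A : Set} {x : A} {xs} → x ∈ xs → ℕ.NonZero (length xs)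
∈⇒nonEmpty (here _)  = _
∈⇒nonEmpty (there _) = _

signs : List Sign
signs = Sign.+ ∷ Sign.- ∷ []

signs-complete : ∀ s → s ∈ signs
signs-complete Sign.+ = here refl
signs-complete Sign.- = there (here refl)

signs-unique : Unique signs
signs-unique = ((λ ()) ∷ []) ∷ ([] ∷ [])

plusOnes : ∀ n → Vec Sign n
plusOnes zero    = []
plusOnes (suc n) = Sign.+ ∷ plusOnes n

cube : ℕ → FiniteSet
cube n = record
  { Element  = Vec Sign n
  ; _≟_      = ≡-dec Signₚ._≟_
  ; elements = allVecs signs n
  ; complete = allVecs-complete signs-complete
  ; unique   = allVecs-unique signs-unique n
  ; nonEmpty = ∈⇒nonEmpty (allVecs-complete signs-complete (plusOnes n))
  }

allSubsets : ∀ n → List (Subset n)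
allSubsets = allVecs (inside ∷ outside ∷ [])

module Summation {c ℓ} (R : CommutativeRing c ℓ) where
  open CommutativeRing R

  ∑ : ∀ {I : Set} → List I → (I → Carrier) → Carrier
  ∑ is g = foldr (λ i s → g i + s) 0# is

-- The polynomial ring R[V], presented as the free commutative R-algebra on V.

module Polynomials {c ℓ} (R : CommutativeRing c ℓ) (V : Set) where
  private module R = CommutativeRing R

  infixl 6 _⊕_
  infixl 7 _⊗_
  data Poly : Set c where
    con     : R.Carrier → Poly
    var     : V → Poly
    _⊕_ _⊗_ : Poly → Poly → Poly

  infix 4 _≋_
  data _≋_ : Poly → Poly → Set (c ⊔ ℓ) where
    ≋-refl      : ∀ {p} → p ≋ p
    ≋-sym       : ∀ {p q} → p ≋ q → q ≋ p
    ≋-trans     : ∀ {p q r} → p ≋ q → q ≋ r → p ≋ r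
    ⊕-cong      : ∀ {p p′ q q′} → p ≋ p′ → q ≋ q′ → p ⊕ q ≋ p′ ⊕ q′
    ⊗-cong      : ∀ {p p′ q q′} → p ≋ p′ → q ≋ q′ → p ⊗ q ≋ p′ ⊗ q′
    con-cong    : ∀ {a b} → a R.≈ b → con a ≋ con b
    con-+       : ∀ a b → con (a R.+ b) ≋ con a ⊕ con b
    con-*       : ∀ a b → con (a R.* b) ≋ con a ⊗ con b
    ⊕-assoc     : ∀ p q r → (p ⊕ q) ⊕ r ≋ p ⊕ (q ⊕ r)
    ⊕-comm      : ∀ p q → p ⊕ q ≋ q ⊕ p
    ⊕-identityˡ : ∀ p → con R.0# ⊕ p ≋ p
    ⊗-assoc     : ∀ p q r → (p ⊗ q) ⊗ r ≋ p ⊗ (q ⊗ r)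
    ⊗-comm      : ∀ p q → p ⊗ q ≋ q ⊗ p
    ⊗-identityˡ : ∀ p → con R.1# ⊗ p ≋ p
    ⊗-zeroˡ     : ∀ p → con R.0# ⊗ p ≋ con R.0#
    ⊗-distribˡ  : ∀ p q r → p ⊗ (q ⊕ r) ≋ p ⊗ q ⊕ p ⊗ r

  ⊝_ : Poly → Poly
  ⊝ p = con (R.- R.1#) ⊗ p

  private
    ⊗-distribʳ : ∀ p q r → (q ⊕ r) ⊗ p ≋ q ⊗ p ⊕ r ⊗ p
    ⊗-distribʳ p q r =
      ≋-trans (⊗-comm (q ⊕ r) p)
        (≋-trans (⊗-distribˡ p q r) (⊕-cong (⊗-comm p q) (⊗-comm p r)))

    ⊝-inverseˡ : ∀ p → (⊝ p) ⊕ p ≋ con R.0#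
    ⊝-inverseˡ p =
      ≋-trans (⊕-cong ≋-refl (≋-sym (⊗-identityˡ p)))
        (≋-trans (≋-sym (⊗-distribʳ p (con (R.- R.1#)) (con R.1#)))
          (≋-trans (⊗-cong (≋-trans (≋-sym (con-+ (R.- R.1#) R.1#))
                                    (con-cong (R.-‿inverseˡ R.1#)))
                           ≋-refl)
            (⊗-zeroˡ p)))

    viaComm : ∀ {p q r} (_∙_ : Poly → Poly → Poly) →
              (∀ p q → p ∙ q ≋ q ∙ p) → p ∙ q ≋ r → q ∙ p ≋ r
    viaComm _∙_ comm e = ≋-trans (comm _ _) e

  polyRing : CommutativeRing c (c ⊔ ℓ)
  polyRing = record
    { Carrier = Poly
    ; _≈_ = _≋_
    ; _+_ = _⊕_
    ; _*_ = _⊗_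
    ; -_  = ⊝_
    ; 0#  = con R.0#
    ; 1#  = con R.1#
    ; isCommutativeRing = record
      { isRing = record
        { +-isAbelianGroup = record
          { isGroup = record
            { isMonoid = record
              { isSemigroup = record
                { isMagma = record
                  { isEquivalence = record
                    { refl = ≋-refl ; sym = ≋-sym ; trans = ≋-trans }
                  ; ∙-cong = ⊕-cong
                  }
                ; assoc = ⊕-assoc
                }
              ; identity = ⊕-identityˡ
                         , λ p → viaComm _⊕_ ⊕-comm (⊕-identityˡ p)
              }
            ; inverse = ⊝-inverseˡ
                      , λ p → viaComm _⊕_ ⊕-comm (⊝-inverseˡ p)
            ; ⁻¹-cong = ⊗-cong ≋-refl
            }
          ; comm = ⊕-comm
          }
        ; *-cong = ⊗-cong
        ; *-assoc = ⊗-assoc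
        ; *-identity = ⊗-identityˡ
                     , λ p → viaComm _⊗_ ⊗-comm (⊗-identityˡ p)
        ; distrib = ⊗-distribˡ , ⊗-distribʳ
        }
      ; *-comm = ⊗-comm
      }
    }

  open RawSemiringDefs (Semiring.rawSemiring (CommutativeRing.semiring polyRing)) public using (_^_)
  open Summation polyRing public using () renaming (∑ to ∑ᴾ)

  -- Degree≤ r p: the polynomial denoted by p, and not merely the expression p,
  -- has total degree at most r.  Closure under _≋_ allows cancellation.
  data Degree≤ : ℕ → Poly → Set (c ⊔ ℓ) where
    con-deg : ∀ a → Degree≤ 0 (con a)
    var-deg : ∀ v → Degree≤ 1 (var v)
    ⊕-deg   : ∀ {r p q} → Degree≤ r p → Degree≤ r q → Degree≤ r (p ⊕ q)
    ⊗-deg   : ∀ {r s p q} → Degree≤ r p → Degree≤ s q → Degree≤ (r ℕ.+ s) (p ⊗ q)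
    ≤-deg   : ∀ {r s p} → r ℕ.≤ s → Degree≤ r p → Degree≤ s p
    ≋-deg   : ∀ {r p q} → p ≋ q → Degree≤ r p → Degree≤ r q

  ^-deg : ∀ {r p} → Degree≤ r p → ∀ k → Degree≤ (k ℕ.* r) (p ^ k)
  ^-deg p≤r zero    = con-deg R.1#
  ^-deg p≤r (suc k) = ⊗-deg p≤r (^-deg p≤r k)

  ∑ᴾ-deg : ∀ {r} {I : Set} (is : List I) {g : I → Poly} →
           (∀ i → Degree≤ r (g i)) → Degree≤ r (∑ᴾ is g)
  ∑ᴾ-deg []       g≤r = ≤-deg z≤n (con-deg R.0#)
  ∑ᴾ-deg (i ∷ is) g≤r = ⊕-deg (g≤r i) (∑ᴾ-deg is g≤r)

module OverReals {c ℓ₁ ℓ₂} (ℝ : Reals c ℓ₁ ℓ₂) where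
  open Reals ℝ using
    ( Carrier; _≈_; _<_; _≤_; _#_; _+_; _*_; -_; 0#; 1#; fromℕ; commutativeRing
    ; isStrictPartialOrder; +-monoˡ-<; *-pos; #⇒invertible; invertible⇒# )
  private
    module R  = CommutativeRing commutativeRing
    module RP = RingProperties R.ring
    module AP = AbelianGroupProperties R.+-abelianGroup
    module <  = IsStrictPartialOrder isStrictPartialOrder
  open Summation commutativeRing public using (∑)

  private
    x-0≈x : ∀ x → x R.- 0# ≈ x
    x-0≈x x = R.trans (R.+-congˡ AP.ε⁻¹≈ε) (R.+-identityʳ x)

    1#0 : 1# # 0#
    1#0 = invertible⇒# (1# , R.trans (R.*-identityˡ _) (x-0≈x 1#)
                           , R.trans (R.*-identityʳ _) (x-0≈x 1#))

    0<1 : 0# < 1#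
    0<1 with 1#0
    ... | inj₂ p = p
    ... | inj₁ p = <.<-respʳ-≈ (R.trans (R.sym (RP.-‿distribˡ-* 1# (- 1#)))
                                 (R.trans (R.-‿cong (R.*-identityˡ (- 1#)))
                                          (AP.⁻¹-involutive 1#)))
                               (*-pos 0<-1 0<-1)
      where
      0<-1 : 0# < - 1#
      0<-1 = <.<-respˡ-≈ (R.-‿inverseʳ 1#)
               (<.<-respʳ-≈ (R.+-identityˡ (- 1#)) (+-monoˡ-< (- 1#) p))

    0<fromℕ : ∀ n → 0# < fromℕ (suc n)
    0<fromℕ zero    = <.<-respʳ-≈ (R.sym (R.+-identityʳ 1#)) 0<1
    0<fromℕ (suc n) = <.trans (0<fromℕ n)
      (<.<-respˡ-≈ (R.+-identityˡ _) (+-monoˡ-< (fromℕ (suc n)) 0<1))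

  recip : ∀ n → .{{ℕ.NonZero n}} → Carrier
  recip (suc n) = proj₁ (#⇒invertible {fromℕ (suc n)} {0#} (inj₂ (0<fromℕ n)))

  recip-inverse : ∀ n .{{_ : ℕ.NonZero n}} → recip n * fromℕ n ≈ 1#
  recip-inverse (suc n) with #⇒invertible {fromℕ (suc n)} {0#} (inj₂ (0<fromℕ n))
  ... | _ , inv , _ = R.trans (R.*-congˡ (R.sym (x-0≈x _))) inv

  recipCard : FiniteSet → Carrier
  recipCard U = recip (length (elements U)) {{FiniteSet.nonEmpty U}}

  𝔼 : (U : FiniteSet) → (Element U → Carrier) → Carrier
  𝔼 U g = recipCard U * ∑ (elements U) g

  record LinearOperator (U V : FiniteSet) : Set (c ⊔ ℓ₁) where
    field
      apply      : (Element U → Carrier) → (Element V → Carrier)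
      apply-cong : ∀ {f g} → (∀ u → f u ≈ g u) → ∀ v → apply f v ≈ apply g v
      apply-+    : ∀ f g v → apply (λ u → f u + g u) v ≈ apply f v + apply g v
      apply-*    : ∀ a f v → apply (λ u → a * f u) v ≈ a * apply f v

  δ : (U : FiniteSet) → Element U → Element U → Carrier
  δ U u u′ with FiniteSet._≟_ U u u′
  ... | yes _ = 1#
  ... | no  _ = 0#

  module _ (U : FiniteSet) where
    open Polynomials commutativeRing (Element U)

    -- Pseudo-expectations act on polynomials of degree at most r; the value does
    -- not depend on the degree proof, by the case p = q of E-cong.
    record PseudoExpectation (r : ℕ) : Set (c ⊔ ℓ₁ ⊔ ℓ₂) where
      field
        E      : (p : Poly) → Degree≤ r p → Carrier
        E-cong : ∀ {p q} (dp : Degree≤ r p) (dq : Degree≤ r q) →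
                 p ≋ q → E p dp ≈ E q dq
        E-+    : ∀ {p q} (dp : Degree≤ r p) (dq : Degree≤ r q) (d : Degree≤ r (p ⊕ q)) →
                 E (p ⊕ q) d ≈ E p dp + E q dq
        E-*    : ∀ {p} a (dp : Degree≤ r p) (d : Degree≤ r (con a ⊗ p)) →
                 E (con a ⊗ p) d ≈ a * E p dp
        E-1    : (d : Degree≤ r (con 1#)) → E (con 1#) d ≈ 1#
        E-sq   : ∀ {p k} → Degree≤ k p → 2 ℕ.* k ℕ.≤ r → (d : Degree≤ r (p ^ 2)) →
                 0# ≤ E (p ^ 2) d

    𝔼ᴾ : (V : FiniteSet) → (Element V → Poly) → Poly
    𝔼ᴾ V g = con (recipCard V) ⊗ ∑ᴾ (elements V) g

    𝔼ᴾ-deg : ∀ {r} V {g : Element V → Poly} →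
             (∀ v → Degree≤ r (g v)) → Degree≤ r (𝔼ᴾ V g)
    𝔼ᴾ-deg V g≤r = ⊗-deg (con-deg _) (∑ᴾ-deg (elements V) g≤r)

    ‖f‖₂² : Poly
    ‖f‖₂² = 𝔼ᴾ U (λ u → var u ^ 2)

    sphere : Poly
    sphere = (‖f‖₂² ⊕ ⊝ con 1#) ^ 2

    sphere-deg : Degree≤ 4 sphere
    sphere-deg = ^-deg (⊕-deg (𝔼ᴾ-deg U (λ u → ^-deg (var-deg u) 2))
                              (⊗-deg (con-deg _) (≤-deg z≤n (con-deg _)))) 2

    module _ {V : FiniteSet} (A : LinearOperator U V) where
      open LinearOperator A

      -- (Af)(v) as a linear form in the indeterminates f(u), via the matrix of A.
      Af : Element V → Poly
      Af v = ∑ᴾ (elements U) (λ u → con (apply (δ U u) v) ⊗ var u)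

      -- Fourth powers of reals are fourth powers of their absolute values.
      ‖Af‖₄⁴ : Poly
      ‖Af‖₄⁴ = 𝔼ᴾ V (λ v → Af v ^ 4)

      ‖Af‖₄⁴-deg : Degree≤ 4 ‖Af‖₄⁴
      ‖Af‖₄⁴-deg = 𝔼ᴾ-deg V λ v →
        ^-deg (∑ᴾ-deg (elements U) λ u → ⊗-deg (con-deg _) (var-deg u)) 4

  -- Tensor-SDP⁽ʳ⁾(A) ≤ b: as Tensor-SDP⁽ʳ⁾(A) is a maximum, this says that the
  -- objective is at most b at every feasible point.
  TensorSDP⁽_⁾≤ : ∀ r {4≤r : 4 ℕ.≤ r} {U V} → LinearOperator U V → Carrier → Set (c ⊔ ℓ₁ ⊔ ℓ₂)
  TensorSDP⁽_⁾≤ r {4≤r} {U} A b =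
    (Ẽ : PseudoExpectation U r) → let open PseudoExpectation Ẽ in
    E (sphere U) (≤-deg 4≤r (sphere-deg U)) ≈ 0# →
    E (‖Af‖₄⁴ U A) (≤-deg 4≤r (‖Af‖₄⁴-deg U A)) ≤ b
    where open Polynomials commutativeRing (Element U)

  TensorSDP≤ : ∀ {U V} → LinearOperator U V → Carrier → Set (c ⊔ ℓ₁ ⊔ ℓ₂)
  TensorSDP≤ = TensorSDP⁽ 4 ⁾≤ {ℕₚ.≤-refl}

  ⟦_⟧ : Sign → Carrier
  ⟦ Sign.+ ⟧ = 1#
  ⟦ Sign.- ⟧ = - 1#

  χ : ∀ {n} → Subset n → Vec Sign n → Carrier
  χ []            []      = 1#
  χ (inside  ∷ α) (s ∷ x) = ⟦ s ⟧ * χ α x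
  χ (outside ∷ α) (_ ∷ x) = χ α x

  -- The coefficient f̂(α) = 𝔼 f χ_α of f in the orthonormal basis of characters.
  fourier : ∀ {n} → (Vec Sign n → Carrier) → Subset n → Carrier
  fourier {n} f α = 𝔼 (cube n) (λ x → f x * χ α x)

  lowSubsets : ∀ n → ℕ → List (Subset n)
  lowSubsets n d = filter (λ α → ∣ α ∣ ≤? d) (allSubsets n)

  private
    ∑-cong : ∀ {I : Set} (is : List I) {g h : I → Carrier} →
             (∀ i → g i ≈ h i) → ∑ is g ≈ ∑ is h
    ∑-cong []       e = R.refl
    ∑-cong (i ∷ is) e = R.+-cong (e i) (∑-cong is e)

    interchange : ∀ a b x y → (a + b) + (x + y) ≈ (a + x) + (b + y)
    interchange a b x y =
      R.trans (R.+-assoc a b (x + y))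
        (R.trans (R.+-congˡ (R.trans (R.sym (R.+-assoc b x y))
                   (R.trans (R.+-congʳ (R.+-comm b x)) (R.+-assoc x b y))))
          (R.sym (R.+-assoc a x (b + y))))

    ∑-+ : ∀ {I : Set} (is : List I) (g h : I → Carrier) →
          ∑ is (λ i → g i + h i) ≈ ∑ is g + ∑ is h
    ∑-+ []       g h = R.sym (R.+-identityˡ 0#)
    ∑-+ (i ∷ is) g h = R.trans (R.+-congˡ (∑-+ is g h)) (interchange _ _ _ _)

    ∑-* : ∀ {I : Set} (is : List I) a (g : I → Carrier) →
          ∑ is (λ i → a * g i) ≈ a * ∑ is g
    ∑-* []       a g = R.sym (R.zeroʳ a)
    ∑-* (i ∷ is) a g = R.trans (R.+-congˡ (∑-* is a g)) (R.sym (R.distribˡ a _ _))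

    exchange : ∀ a b x → a * (b * x) ≈ b * (a * x)
    exchange a b x = R.trans (R.sym (R.*-assoc a b x))
      (R.trans (R.*-congʳ (R.*-comm a b)) (R.*-assoc b a x))

    fourier-cong : ∀ {n} {f g : Vec Sign n → Carrier} → (∀ x → f x ≈ g x) →
                   ∀ α → fourier f α ≈ fourier g α
    fourier-cong {n} e α =
      R.*-congˡ (∑-cong (elements (cube n)) (λ x → R.*-congʳ (e x)))

    fourier-+ : ∀ {n} (f g : Vec Sign n → Carrier) α →
                fourier (λ x → f x + g x) α ≈ fourier f α + fourier g α
    fourier-+ {n} f g α =
      R.trans (R.*-congˡ (R.trans (∑-cong (elements (cube n)) (λ x → R.distribʳ _ _ _))
                                  (∑-+ (elements (cube n)) _ _)))
              (R.distribˡ _ _ _)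

    fourier-* : ∀ {n} a (f : Vec Sign n → Carrier) α →
                fourier (λ x → a * f x) α ≈ a * fourier f α
    fourier-* {n} a f α =
      R.trans (R.*-congˡ (R.trans (∑-cong (elements (cube n)) (λ x → R.*-assoc _ _ _))
                                  (∑-* (elements (cube n)) a _)))
              (exchange _ _ _)

  𝒫 : (n d : ℕ) → LinearOperator (cube n) (cube n)
  𝒫 n d = record
    { apply      = λ f x → ∑ (lowSubsets n d) (λ α → fourier f α * χ α x)
    ; apply-cong = λ e x → ∑-cong low (λ α → R.*-congʳ (fourier-cong e α))
    ; apply-+    = λ f g x →
        R.trans (∑-cong low (λ α → R.trans (R.*-congʳ (fourier-+ f g α)) (R.distribʳ _ _ _)))
                (∑-+ low _ _)
    ; apply-*    = λ a f x →
        R.trans (∑-cong low (λ α → R.trans (R.*-congʳ (fourier-* a f α)) (R.*-assoc _ _ _)))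
                (∑-* low a _)
    }
    where
    low : List (Subset n)
    low = lowSubsets n d

{-# OPTIONS --safe #-}

-- For F = ∑ f̂_α χ_α with indeterminate coefficients, put W f = ∑ 3^|α| f̂_α².  The inequality
-- 𝔼 F² G² ≼ W f · W g holds up to a sum of squares of quadratic forms: by induction on the
-- dimension, splitting off one coordinate as F = f₀ ± f₁, G = g₀ ± g₁, it reduces to
--   𝔼 (f₀ ± f₁)² (g₀ ± g₁)² ≼ f₀²g₀² + f₁²g₁² + 3 f₀²g₁² + 3 f₁²g₀²,
-- since (W f₀ + 3 W f₁)(W g₀ + 3 W g₁) has coefficients 1, 9, 3, 3.  For f = g of degree at most d,
-- W f ≼ 3^d ∑ f̂_α² ≼ 3^d ∥f∥₂² by Parseval, and squaring gives ∥𝒫_d f∥₄⁴ ≼ 9^d ∥f∥₂⁴.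
-- Finally Ẽ ∥f∥₂⁴ = Ẽ q² + 2 Ẽ q + 1 with q = ∥f∥₂² − 1 and Ẽ q² = 0, which forces Ẽ q ≤ 0.
module Submission where

open import Defs
open import Algebra.Apartness.Structures using (IsHeytingField)
open import Algebra.Bundles using (CommutativeRing)
import Algebra.Properties.CommutativeMonoid.Mult as MonoidMult
import Algebra.Properties.Ring as RingProperties
import Algebra.Properties.Semiring.Mult as SemiringMult
import Algebra.Solver.Ring.NaturalCoefficients.Default as NaturalSolver
open import Data.Bool.Base using (if_then_else_; true; false)
open import Data.Fin.Subset using (Subset; inside; outside; ∣_∣)
open import Data.List.Base using (List; []; _∷_; _++_; map; filter; length)
open import Data.List.Membership.Propositional using (_∈_)
open import Data.List.Relation.Unary.All using (All; []; _∷_; lookup) renaming (map to All-map)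
open import Data.List.Relation.Unary.AllPairs using ([]; _∷_)
open import Data.List.Relation.Unary.Any using (here; there)
open import Data.List.Relation.Unary.Unique.Propositional using (Unique)
open import Data.List.Properties using (length-++; length-map)
open import Data.Nat.Base as ℕ using (ℕ; zero; suc; z≤n; s≤s; _≤_; _^_)
import Data.Nat.Properties as ℕₚ
open import Data.Product.Base using (∃-syntax; _×_; _,_)
open import Data.Sign.Base using (Sign)
open import Data.Sum.Base using (_⊎_; inj₁; inj₂)
open import Data.Vec.Base using (Vec; []; _∷_)
open import Function.Base using (_∘_)
open import Level using (_⊔_)
open import Relation.Binary.PropositionalEquality.Core as ≡ using (_≡_; _≢_)
import Relation.Binary.Reasoning.Setoid as SetoidReasoning
open import Relation.Binary.Structures using (IsStrictPartialOrder)
open import Relation.Nullary.Decidable using (Dec; yes; no; does)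
open import Relation.Nullary.Negation using (contradiction)
open import Relation.Unary using (Decidable)

-- Turns the list length inside `recipCard` into the power of two that Parseval's identity and the
-- hypercontractive induction produce.
length-allVecs : ∀ {A : Set} (a b : A) n → length (allVecs (a ∷ b ∷ []) n) ≡ 2 ^ n
length-allVecs a b zero    = ≡.refl
length-allVecs a b (suc n) = ≡.trans (length-++ (map (a ∷_) vs))
  (≡.cong₂ ℕ._+_ (≡.trans (length-map (a ∷_) vs) (length-allVecs a b n))
    (≡.trans (length-++ (map (b ∷_) vs))
      (≡.cong (ℕ._+ 0) (≡.trans (length-map (b ∷_) vs) (length-allVecs a b n)))))
  where vs = allVecs (a ∷ b ∷ []) n

-- Finite sums and polynomial identities in commutative rings.

module RingLemmas {c ℓ} (R : CommutativeRing c ℓ) where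
  open CommutativeRing R
  open Summation R
  open SemiringMult semiring renaming (_×_ to _·_)
  open MonoidMult +-commutativeMonoid using (×-distrib-+)
  open NaturalSolver commutativeSemiring
  open SetoidReasoning setoid

  private
    2× 3× 4× : ∀ {m} → Polynomial m → Polynomial m
    2× x = x :+ (x :+ con 0)
    3× x = x :+ 2× x
    4× x = x :+ 3× x

  ·-* : ∀ n x → n · x ≈ (n · 1#) * x
  ·-* n x = sym (trans (×-assoc-* n 1# x) (×-congʳ n (*-identityˡ x)))

  module _ {I : Set} where

    ∑-cong : ∀ (is : List I) {g h : I → Carrier} → (∀ i → g i ≈ h i) → ∑ is g ≈ ∑ is h
    ∑-cong []       e = refl
    ∑-cong (i ∷ is) e = +-cong (e i) (∑-cong is e)

    ∑-0 : ∀ (is : List I) → ∑ is (λ _ → 0#) ≈ 0#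
    ∑-0 []       = refl
    ∑-0 (i ∷ is) = trans (+-identityˡ _) (∑-0 is)

    ∑-+ : ∀ (is : List I) (g h : I → Carrier) → ∑ is (λ i → g i + h i) ≈ ∑ is g + ∑ is h
    ∑-+ []       g h = sym (+-identityˡ 0#)
    ∑-+ (i ∷ is) g h = trans (+-congˡ (∑-+ is g h))
      (solve 4 (λ a b x y → (a :+ b) :+ (x :+ y) := (a :+ x) :+ (b :+ y)) refl _ _ _ _)

    ∑-* : ∀ (is : List I) a (g : I → Carrier) → ∑ is (λ i → a * g i) ≈ a * ∑ is g
    ∑-* []       a g = sym (zeroʳ a)
    ∑-* (i ∷ is) a g = trans (+-congˡ (∑-* is a g)) (sym (distribˡ a _ _))

    ∑-*ʳ : ∀ (is : List I) a (g : I → Carrier) → ∑ is (λ i → g i * a) ≈ ∑ is g * a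
    ∑-*ʳ is a g = trans (∑-cong is (λ i → *-comm (g i) a)) (trans (∑-* is a g) (*-comm a _))

    ∑-· : ∀ (is : List I) n (g : I → Carrier) → ∑ is (λ i → n · g i) ≈ n · ∑ is g
    ∑-· is n g = begin
      ∑ is (λ i → n · g i)          ≈⟨ ∑-cong is (λ i → ·-* n (g i)) ⟩
      ∑ is (λ i → (n · 1#) * g i)   ≈⟨ ∑-* is _ g ⟩
      (n · 1#) * ∑ is g             ≈⟨ ·-* n _ ⟨
      n · ∑ is g                    ∎

    ∑-++ : ∀ (is js : List I) (g : I → Carrier) → ∑ (is ++ js) g ≈ ∑ is g + ∑ js g
    ∑-++ []       js g = sym (+-identityˡ _)
    ∑-++ (i ∷ is) js g = trans (+-congˡ (∑-++ is js g)) (sym (+-assoc _ _ _))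

    ∑-map : ∀ {J : Set} (φ : I → J) (is : List I) (g : J → Carrier) →
            ∑ (map φ is) g ≈ ∑ is (g ∘ φ)
    ∑-map φ []       g = refl
    ∑-map φ (i ∷ is) g = +-congˡ (∑-map φ is g)

    ∑-filter : ∀ {p} {P : I → Set p} (P? : Decidable P) (is : List I) (g : I → Carrier) →
               ∑ (filter P? is) g ≈ ∑ is (λ i → if does (P? i) then g i else 0#)
    ∑-filter P? []       g = refl
    ∑-filter P? (i ∷ is) g with does (P? i)
    ... | true  = +-congˡ (∑-filter P? is g)
    ... | false = trans (∑-filter P? is g) (sym (+-identityˡ _))

    ∑-vanishing : ∀ {is : List I} {g : I → Carrier} → All (λ i → g i ≈ 0#) is → ∑ is g ≈ 0#
    ∑-vanishing []       = refl
    ∑-vanishing (e ∷ es) = trans (+-cong e (∑-vanishing es)) (+-identityˡ 0#)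

    ∑-single : ∀ {is : List I} {i} {g : I → Carrier} → Unique is → i ∈ is →
               (∀ {j} → i ≢ j → g j ≈ 0#) → ∑ is g ≈ g i
    ∑-single (i≢ ∷ uniq) (here ≡.refl) e =
      trans (+-congˡ (∑-vanishing (All-map e i≢))) (+-identityʳ _)
    ∑-single (j≢ ∷ uniq) (there i∈) e =
      trans (+-congʳ (e (λ i≡j → lookup j≢ i∈ (≡.sym i≡j))))
        (trans (+-identityˡ _) (∑-single uniq i∈ e))

  ∑-swap : ∀ {I J : Set} (is : List I) (js : List J) (g : I → J → Carrier) →
           ∑ is (λ i → ∑ js (g i)) ≈ ∑ js (λ j → ∑ is (λ i → g i j))
  ∑-swap []       js g = sym (∑-0 js)
  ∑-swap (i ∷ is) js g = trans (+-congˡ (∑-swap is js g)) (sym (∑-+ js _ _))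

  -- Serves the inductions on dimension: points and subsets are both vectors over a two-letter
  -- alphabet, so one lemma splits off a coordinate for either.
  ∑-allVecs : ∀ {A : Set} (a b : A) n (g : Vec A (suc n) → Carrier) →
              ∑ (allVecs (a ∷ b ∷ []) (suc n)) g ≈
              ∑ (allVecs (a ∷ b ∷ []) n) (g ∘ (a ∷_)) + ∑ (allVecs (a ∷ b ∷ []) n) (g ∘ (b ∷_))
  ∑-allVecs a b n g = begin
    ∑ (map (a ∷_) vs ++ (map (b ∷_) vs ++ [])) g     ≈⟨ ∑-++ (map (a ∷_) vs) _ g ⟩
    ∑ (map (a ∷_) vs) g + ∑ (map (b ∷_) vs ++ []) g
      ≈⟨ +-cong (∑-map _ vs g) (trans (∑-++ (map (b ∷_) vs) [] g)
                                (trans (+-identityʳ _) (∑-map _ vs g))) ⟩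
    ∑ vs (g ∘ (a ∷_)) + ∑ vs (g ∘ (b ∷_))            ∎
    where vs = allVecs (a ∷ b ∷ []) n

  -- Identities in R[ι]/(1 + ι): the element −1 is kept as a variable ι so that
  -- what remains are semiring identities.
  module _ {ι} (1+ι≈0 : 1# + ι ≈ 0#) where

    x+ιx≈0 : ∀ x → x + ι * x ≈ 0#
    x+ιx≈0 x = trans (solve 2 (λ ι x → x :+ ι :* x := (con 1 :+ ι) :* x) refl ι x)
                 (trans (*-congʳ 1+ι≈0) (zeroˡ x))

    -- Adding the vanishing `1# + ι` to `ι * ι` leaves `1#` plus `ι + ι * ι`, and the latter is a
    -- multiple of `1# + ι`.
    ιι≈1 : ι * ι ≈ 1#
    ιι≈1 = begin
      ι * ι                  ≈⟨ +-identityʳ _ ⟨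
      ι * ι + 0#             ≈⟨ +-congˡ 1+ι≈0 ⟨
      ι * ι + (1# + ι)
        ≈⟨ solve 1 (λ ι → ι :* ι :+ (con 1 :+ ι) := con 1 :+ (ι :+ ι :* ι)) refl ι ⟩
      1# + (ι + ι * ι)       ≈⟨ +-congˡ (x+ιx≈0 ι) ⟩
      1# + 0#                ≈⟨ +-identityʳ _ ⟩
      1#                     ∎

    -- Since ι² = 1, a product again splits into a part free of `ι` and a part multiplied by `ι`;
    -- the latter changes sign when the split coordinate is flipped.
    conjugate-* : ∀ p q r s →
      (p + ι * q) * (r + ι * s) ≈ (p * r + q * s) + ι * (p * s + q * r)
    conjugate-* p q r s = begin
      (p + ι * q) * (r + ι * s)
        ≈⟨ solve 5 (λ ι p q r s → (p :+ ι :* q) :* (r :+ ι :* s) :=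
             p :* r :+ (ι :* ι) :* (q :* s) :+ ι :* (p :* s :+ q :* r)) refl ι p q r s ⟩
      p * r + (ι * ι) * (q * s) + ι * (p * s + q * r)
        ≈⟨ +-congʳ (+-congˡ (trans (*-congʳ ιι≈1) (*-identityˡ _))) ⟩
      (p * r + q * s) + ι * (p * s + q * r) ∎

    -- Summing over both signs of a coordinate cancels the odd part and doubles the even part.
    conjugate-+ : ∀ x y → (x + y) + (x + ι * y) ≈ 2 · x
    conjugate-+ x y = begin
      (x + y) + (x + ι * y)
        ≈⟨ solve 3 (λ x y z → (x :+ y) :+ (x :+ z) := 2× x :+ (y :+ z)) refl x y (ι * y) ⟩
      2 · x + (y + ι * y) ≈⟨ +-congˡ (x+ιx≈0 y) ⟩
      2 · x + 0#          ≈⟨ +-identityʳ _ ⟩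
      2 · x               ∎

    parallelogram : ∀ p q →
      (p + q) * (p + q) + (p + ι * q) * (p + ι * q) ≈ 2 · (p * p + q * q)
    parallelogram p q = begin
      (p + q) * (p + q) + (p + ι * q) * (p + ι * q)
        ≈⟨ +-cong (solve 2 (λ p q → (p :+ q) :* (p :+ q) :=
                                    (p :* p :+ q :* q) :+ (p :* q :+ q :* p)) refl p q)
                  (conjugate-* p q p q) ⟩
      _ ≈⟨ conjugate-+ _ _ ⟩
      2 · (p * p + q * q) ∎

    -- The cross term 2pq is moved to the left-hand side, so that the right-hand side is a plain sum
    -- of squares.
    square-of-difference : ∀ p q →
      (p + ι * q) * (p + ι * q) + p * (q + q) ≈ p * p + q * q
    square-of-difference p q = begin
      (p + ι * q) * (p + ι * q) + p * (q + q)
        ≈⟨ +-congʳ (conjugate-* p q p q) ⟩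
      (p * p + q * q + ι * (p * q + q * p)) + p * (q + q)
        ≈⟨ solve 3 (λ ι p q → (p :* p :+ q :* q :+ ι :* (p :* q :+ q :* p)) :+ p :* (q :+ q) :=
             (p :* p :+ q :* q) :+ ((p :* q :+ q :* p) :+ ι :* (p :* q :+ q :* p))) refl ι p q ⟩
      (p * p + q * q) + ((p * q + q * p) + ι * (p * q + q * p))
        ≈⟨ +-congˡ (x+ιx≈0 _) ⟩
      (p * p + q * q) + 0#   ≈⟨ +-identityʳ _ ⟩
      p * p + q * q ∎

    -- The two-point inequality 𝔼 (p ± q)² (r ± s)² ≤ p²r² + q²s² + 3 (p²s² + q²r²), whose
    -- slack is 2 (ps − qr)².
    two-point : ∀ p q r s →
      let h = (p * s + ι * (q * r)) + (p * s + ι * (q * r)) in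
      ((p + q) * (p + q)) * ((r + s) * (r + s))
        + ((p + ι * q) * (p + ι * q)) * ((r + ι * s) * (r + ι * s)) + h * h
      ≈ 2 · (((p * p) * (r * r) + (q * q) * (s * s))
              + 3 · ((p * p) * (s * s) + (q * q) * (r * r)))
    two-point p q r s = begin
      _ ≈⟨ +-cong (+-cong
             (solve 4 (λ p q r s → ((p :+ q) :* (p :+ q)) :* ((r :+ s) :* (r :+ s)) :=
                even p q r s :+ odd p q r s) refl p q r s)
             (trans (*-cong (conjugate-* p q p q) (conjugate-* r s r s)) (conjugate-* _ _ _ _)))
             -- Here `h` is `k + k` with k = ps - qr. Summing over both signs instead of averaging
             -- doubles the slack 2k² to 4k², which is the perfect square `h * h`.
             (trans (solve 1 (λ k → (k :+ k) :* (k :+ k) := 4× (k :* k)) refl _)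
                    (×-congʳ 4 (conjugate-* _ _ _ _))) ⟩
      _ ≈⟨ +-congʳ (conjugate-+ _ _) ⟩
      -- Twice `even` contributes 8pqrs and `h * h` contributes ι · 8pqrs; the pair is isolated so
      -- that it cancels in the next step.
      _ ≈⟨ solve 5 (λ ι p q r s →
             2× (even p q r s) :+
             4× (((p :* s) :* (p :* s) :+ (q :* r) :* (q :* r)) :+
                 ι :* ((p :* s) :* (q :* r) :+ (q :* r) :* (p :* s))) :=
             2× (((p :* p) :* (r :* r) :+ (q :* q) :* (s :* s))
                 :+ 3× ((p :* p) :* (s :* s) :+ (q :* q) :* (r :* r))) :+
             (con 8 :* ((p :* q) :* (r :* s)) :+ ι :* (con 8 :* ((p :* q) :* (r :* s)))))
             refl ι p q r s ⟩
      _ ≈⟨ +-congˡ (x+ιx≈0 _) ⟩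
      _ ≈⟨ +-identityʳ _ ⟩
      _ ∎
      where
      -- The parts of (p + q)²(r + s)² that are fixed, respectively negated, by (q, s) ↦ (-q, -s).
      even odd : ∀ {m} (p q r s : Polynomial m) → Polynomial m
      even p q r s = (p :* p :+ q :* q) :* (r :* r :+ s :* s) :+
                     (p :* q :+ q :* p) :* (r :* s :+ s :* r)
      odd  p q r s = (p :* p :+ q :* q) :* (r :* s :+ s :* r) :+
                     (p :* q :+ q :* p) :* (r :* r :+ s :* s)

  -- The product has coefficient 9 at v′w′ where the two-point inequality yields 1. The surplus 8,
  -- doubled by the common factor 2, is the 16 written as `4 · 4 ·`.
  weight-product : ∀ N v v′ w w′ →
    2 · ((N * (v * w) + N * (v′ * w′)) + 3 · (N * (v * w′) + N * (v′ * w)))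
      + 4 · 4 · (N * (v′ * w′))
    ≈ (2 · N) * ((v + 3 · v′) * (w + 3 · w′))
  weight-product N v v′ w w′ = solve 5 (λ N v v′ w w′ →
    2× ((N :* (v :* w) :+ N :* (v′ :* w′)) :+ 3× (N :* (v :* w′) :+ N :* (v′ :* w)))
      :+ 4× (4× (N :* (v′ :* w′))) :=
    2× N :* ((v :+ 3× v′) :* (w :+ 3× w′))) refl N v v′ w w′

-- Sum-of-squares certificates and the order they induce.

module SumsOfSquares {c ℓ} (R : CommutativeRing c ℓ) (V : Set) where
  open Polynomials R V
  private
    module R = CommutativeRing R
    module P = CommutativeRing polyRing
  open SemiringMult P.semiring using (×-homo-+) renaming (_×_ to _·_)
  open NaturalSolver P.commutativeSemiring

  -- The index bounds the degree of the polynomials being squared, so `SOS 2` consists of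
  -- certificates that level 4 can use. Nonnegative scalars enter as repeated sums or through
  -- `SOS 0`, which avoids real square roots.
  data SOS (k : ℕ) : Poly → Set (c ⊔ ℓ) where
    zero   : SOS k (con R.0#)
    square : ∀ {p} → Degree≤ k p → SOS k (p ⊗ p)
    plus   : ∀ {p q} → SOS k p → SOS k q → SOS k (p ⊕ q)
    resp   : ∀ {p q} → p ≋ q → SOS k p → SOS k q

  SOS-degree : ∀ {k p} → SOS k p → Degree≤ (k ℕ.+ k) p
  SOS-degree zero       = ≤-deg z≤n (con-deg _)
  SOS-degree (square d) = ⊗-deg d d
  SOS-degree (plus s t) = ⊕-deg (SOS-degree s) (SOS-degree t)
  SOS-degree (resp e s) = ≋-deg e (SOS-degree s)

  -- Distributivity reduces to a product of two squares, and p²q² = (pq)².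
  SOS-⊗ : ∀ {k l p q} → SOS k p → SOS l q → SOS (k ℕ.+ l) (p ⊗ q)
  SOS-⊗ zero        t = resp (P.sym (P.zeroˡ _)) zero
  SOS-⊗ (plus s s′) t = resp (P.sym (P.distribʳ _ _ _)) (plus (SOS-⊗ s t) (SOS-⊗ s′ t))
  SOS-⊗ (resp e s)  t = resp (P.*-congʳ e) (SOS-⊗ s t)
  SOS-⊗ (square d) zero        = resp (P.sym (P.zeroʳ _)) zero
  SOS-⊗ (square d) (plus t t′) =
    resp (P.sym (P.distribˡ _ _ _)) (plus (SOS-⊗ (square d) t) (SOS-⊗ (square d) t′))
  SOS-⊗ (square d) (resp e t)  = resp (P.*-congˡ e) (SOS-⊗ (square d) t)
  SOS-⊗ (square {p} d) (square {q} d′) =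
    resp (solve 2 (λ p q → (p :* q) :* (p :* q) := (p :* p) :* (q :* q)) P.refl p q)
         (square (⊗-deg d d′))

  SOS-· : ∀ {k p} n → SOS k p → SOS k (n · p)
  SOS-· zero    s = zero
  SOS-· (suc n) s = plus s (SOS-· n s)

  SOS-∑ : ∀ {k} {I : Set} (is : List I) {g : I → Poly} → (∀ i → SOS k (g i)) → SOS k (∑ᴾ is g)
  SOS-∑ []       s = zero
  SOS-∑ (i ∷ is) s = plus (s i) (SOS-∑ is s)

  SOS-ℕ : ∀ n → SOS 0 (n · con R.1#)
  SOS-ℕ n = SOS-· n (resp (⊗-identityˡ _) (square (con-deg R.1#)))

  infix 4 _≼[_]_
  -- The slack is added to the smaller side rather than obtained by subtraction, so the proofs stay
  -- within reach of the semiring solver.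
  _≼[_]_ : Poly → ℕ → Poly → Set (c ⊔ ℓ)
  p ≼[ k ] q = ∃[ s ] SOS k s × p ⊕ s ≋ q

  module _ {k : ℕ} where

    ≋⇒≼ : ∀ {p q} → p ≋ q → p ≼[ k ] q
    ≋⇒≼ e = _ , zero , P.trans (P.+-identityʳ _) e

    ≼-add : ∀ {p s} → SOS k s → p ≼[ k ] p ⊕ s
    ≼-add s = _ , s , P.refl

    ≼-trans : ∀ {p q r} → p ≼[ k ] q → q ≼[ k ] r → p ≼[ k ] r
    ≼-trans (_ , s , e) (_ , t , f) =
      _ , plus s t , P.trans (P.sym (P.+-assoc _ _ _)) (P.trans (P.+-congʳ e) f)

    ⊕-mono : ∀ {p p′ q q′} → p ≼[ k ] p′ → q ≼[ k ] q′ → p ⊕ q ≼[ k ] p′ ⊕ q′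
    ⊕-mono (_ , s , e) (_ , t , f) = _ , plus s t ,
      P.trans (solve 4 (λ a b x y → (a :+ b) :+ (x :+ y) := (a :+ x) :+ (b :+ y)) P.refl _ _ _ _)
              (P.+-cong e f)

    ·-mono : ∀ {p q} n → p ≼[ k ] q → n · p ≼[ k ] n · q
    ·-mono zero    p≼q = ≋⇒≼ P.refl
    ·-mono (suc n) p≼q = ⊕-mono p≼q (·-mono n p≼q)

    ∑-mono : ∀ {I : Set} (is : List I) {g h : I → Poly} →
             (∀ i → g i ≼[ k ] h i) → ∑ᴾ is g ≼[ k ] ∑ᴾ is h
    ∑-mono []       g≼h = ≋⇒≼ P.refl
    ∑-mono (i ∷ is) g≼h = ⊕-mono (g≼h i) (∑-mono is g≼h)

    ⊗-monoʳ : ∀ {l p q a} → SOS l a → p ≼[ k ] q → a ⊗ p ≼[ l ℕ.+ k ] a ⊗ q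
    ⊗-monoʳ sa (_ , s , e) =
      _ , SOS-⊗ sa s , P.trans (P.sym (P.distribˡ _ _ _)) (P.*-congˡ e)

  ·-monoˡ : ∀ {k m n p} → m ≤ n → SOS k p → m · p ≼[ k ] n · p
  ·-monoˡ {m = m} {n} {p} m≤n s = (n ℕ.∸ m) · p , SOS-· (n ℕ.∸ m) s ,
    P.trans (P.sym (×-homo-+ p m (n ℕ.∸ m))) (P.reflexive (≡.cong (_· p) (ℕₚ.m+[n∸m]≡n m≤n)))

  -- For q = p + s the difference of the squares is (2p + s)s, a product of two sums of squares.
  squares-mono : ∀ {k p q} → SOS k p → p ≼[ k ] q → p ⊗ p ≼[ k ℕ.+ k ] q ⊗ q
  squares-mono {p = p} sp (s , ss , e) = _ , SOS-⊗ (plus (plus sp sp) ss) ss ,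
    P.trans (solve 2 (λ p s → p :* p :+ (p :+ p :+ s) :* s := (p :+ s) :* (p :+ s)) P.refl p s)
            (P.*-cong e e)

-- Fourier analysis on the cube with polynomial values, up to Parseval's identity.

module Hypercontractivity {c ℓ₁ ℓ₂} (ℝ : Reals c ℓ₁ ℓ₂) (V : Set) where
  open Reals ℝ using (Carrier; 0#; 1#; -_; commutativeRing)
  open OverReals ℝ using (χ; ⟦_⟧)
  private module R = CommutativeRing commutativeRing
  open Polynomials commutativeRing V hiding (_^_)
  open SumsOfSquares commutativeRing V
  private
    module P = CommutativeRing polyRing
    module L = RingLemmas polyRing
  open SemiringMult P.semiring renaming (_×_ to _·_) using (×-congʳ; ×-assocˡ; ×-homo-+)
  open MonoidMult P.+-commutativeMonoid using (×-distrib-+)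
  open SetoidReasoning P.setoid

  -1ᴾ : Poly
  -1ᴾ = con (- 1#)

  1+-1≋0 : con 1# ⊕ -1ᴾ ≋ con 0#
  1+-1≋0 = P.trans (P.sym (con-+ _ _)) (con-cong (R.-‿inverseʳ 1#))

  characterSum : ∀ {n} → (Subset n → Poly) → Vec Sign n → Poly
  characterSum {n} f x = ∑ᴾ (allSubsets n) (λ α → con (χ α x) ⊗ f α)

  -- Unnormalised: 2ⁿ times the Fourier coefficient. The factor is divided out in `f̂`.
  transform : ∀ {n} → (Vec Sign n → Poly) → Subset n → Poly
  transform {n} v α = ∑ᴾ (allVecs signs n) (λ x → con (χ α x) ⊗ v x)

  -- This is the squared 2-norm of T_ρ f at ρ = √3, the inverse of the noise rate 1/√3.
  weight : ∀ {n} → (Subset n → Poly) → Poly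
  weight {n} f = ∑ᴾ (allSubsets n) (λ α → (3 ^ ∣ α ∣) · (f α ⊗ f α))

  characterSum-∷ : ∀ {n} (f : Subset (suc n) → Poly) s x →
    characterSum f (s ∷ x) ≋
    characterSum (f ∘ (outside ∷_)) x ⊕ con ⟦ s ⟧ ⊗ characterSum (f ∘ (inside ∷_)) x
  characterSum-∷ {n} f s x = begin
    characterSum f (s ∷ x)  ≈⟨ L.∑-allVecs inside outside n _ ⟩
    _ ≈⟨ P.+-congʳ (L.∑-cong (allSubsets n) (λ α →
           P.trans (P.*-congʳ (con-* _ _)) (P.*-assoc _ _ _))) ⟩
    _ ≈⟨ P.+-congʳ (L.∑-* (allSubsets n) _ _) ⟩
    -- `allSubsets` lists `inside` first; the swap puts the part free of the split coordinate in
    -- front.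
    _ ≈⟨ P.+-comm _ _ ⟩
    characterSum (f ∘ (outside ∷_)) x ⊕ con ⟦ s ⟧ ⊗ characterSum (f ∘ (inside ∷_)) x ∎

  characterSum-degree : ∀ {k n} {f : Subset n → Poly} → (∀ α → Degree≤ k (f α)) →
                        ∀ x → Degree≤ k (characterSum f x)
  characterSum-degree d x = ∑ᴾ-deg (allSubsets _) (λ α → ⊗-deg (con-deg (χ α x)) (d α))

  transform-degree : ∀ {k n} {v : Vec Sign n → Poly} → (∀ x → Degree≤ k (v x)) →
                     ∀ α → Degree≤ k (transform v α)
  transform-degree d α = ∑ᴾ-deg (allVecs signs _) (λ x → ⊗-deg (con-deg (χ α x)) (d x))

  transform-outside : ∀ {n} (v : Vec Sign (suc n) → Poly) α →
    transform v (outside ∷ α) ≋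
    transform (v ∘ (Sign.+ ∷_)) α ⊕ transform (v ∘ (Sign.- ∷_)) α
  transform-outside {n} v α = L.∑-allVecs Sign.+ Sign.- n _

  transform-inside : ∀ {n} (v : Vec Sign (suc n) → Poly) α →
    transform v (inside ∷ α) ≋
    transform (v ∘ (Sign.+ ∷_)) α ⊕ -1ᴾ ⊗ transform (v ∘ (Sign.- ∷_)) α
  transform-inside {n} v α = begin
    transform v (inside ∷ α) ≈⟨ L.∑-allVecs Sign.+ Sign.- n _ ⟩
    _ ≈⟨ P.+-cong (L.∑-cong (allVecs signs n) (λ x → P.*-congʳ (con-cong (R.*-identityˡ _))))
                  (L.∑-cong (allVecs signs n) (λ x →
                    P.trans (P.*-congʳ (con-* _ _)) (P.*-assoc _ _ _))) ⟩
    _ ≈⟨ P.+-congˡ (L.∑-* (allVecs signs n) _ _) ⟩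
    transform (v ∘ (Sign.+ ∷_)) α ⊕ -1ᴾ ⊗ transform (v ∘ (Sign.- ∷_)) α ∎

  -- By induction on `n`: the coefficients without and with the split coordinate are the sum and
  -- difference of the half-cube transforms, and the parallelogram law supplies one factor 2 per
  -- coordinate.
  parseval : ∀ {n} (v : Vec Sign n → Poly) →
    ∑ᴾ (allSubsets n) (λ α → transform v α ⊗ transform v α) ≋
    (2 ^ n) · ∑ᴾ (allVecs signs n) (λ x → v x ⊗ v x)
  parseval {zero} v = P.trans (P.+-congʳ (P.*-cong e e))
      (P.sym (P.+-identityʳ _))
    where e = P.trans (P.+-identityʳ _) (P.*-identityˡ _)
  parseval {suc n} v = begin
    _ ≈⟨ L.∑-allVecs inside outside n _ ⟩
    _ ≈⟨ P.+-comm _ _ ⟩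
    _ ≈⟨ L.∑-+ (allSubsets n) _ _ ⟨
    _ ≈⟨ L.∑-cong (allSubsets n) (λ α →
           P.trans (P.+-cong (P.*-cong (transform-outside v α) (transform-outside v α))
                             (P.*-cong (transform-inside v α) (transform-inside v α)))
                   (L.parallelogram 1+-1≋0 _ _)) ⟩
    _ ≈⟨ L.∑-· (allSubsets n) 2 _ ⟩
    _ ≈⟨ ×-congʳ 2 (P.trans (L.∑-+ (allSubsets n) _ _)
           (P.+-cong (parseval (v ∘ (Sign.+ ∷_))) (parseval (v ∘ (Sign.- ∷_))))) ⟩
    _ ≈⟨ ×-congʳ 2 (×-distrib-+ _ _ (2 ^ n)) ⟨
    _ ≈⟨ ×-congʳ 2 (×-congʳ (2 ^ n) (L.∑-allVecs Sign.+ Sign.- n _)) ⟨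
    _ ≈⟨ ×-assocˡ _ 2 (2 ^ n) ⟩
    _ ∎

  -- The hypercontractive inequality.

  weight-∷ : ∀ {n} (f : Subset (suc n) → Poly) →
    weight f ≋ weight (f ∘ (outside ∷_)) ⊕ 3 · weight (f ∘ (inside ∷_))
  weight-∷ {n} f = begin
    weight f ≈⟨ L.∑-allVecs inside outside n _ ⟩
    _ ≈⟨ P.+-comm _ _ ⟩
    _ ≈⟨ P.+-congˡ (L.∑-cong (allSubsets n) (λ α → ×-assocˡ _ 3 (3 ^ ∣ α ∣))) ⟨
    _ ≈⟨ P.+-congˡ (L.∑-· (allSubsets n) 3 _) ⟩
    _ ∎

  weight-SOS : ∀ {k n} {f : Subset n → Poly} → (∀ α → Degree≤ k (f α)) → SOS k (weight f)
  weight-SOS {n = n} d = SOS-∑ (allSubsets n) (λ α → SOS-· (3 ^ ∣ α ∣) (square (d α)))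

  -- The noise-operator form ∥T_{1/√3} f∥₄ ≤ ∥f∥₂ of hypercontractivity, polarised
  -- to two functions so that it can be proved by induction on the dimension.
  hypercontractive : ∀ {n} (f g : Subset n → Poly) →
    (∀ α → Degree≤ 1 (f α)) → (∀ α → Degree≤ 1 (g α)) →
    ∑ᴾ (allVecs signs n) (λ x → (characterSum f x ⊗ characterSum f x) ⊗
                                (characterSum g x ⊗ characterSum g x))
    ≼[ 2 ] ((2 ^ n) · con 1#) ⊗ (weight f ⊗ weight g)
  -- On the one-point cube both sides equal f(∅)² g(∅)², so the slack is zero.
  hypercontractive {zero} f g df dg = ≋⇒≼ (begin
    _ ≈⟨ P.+-identityʳ _ ⟩
    _ ≈⟨ P.*-cong (P.*-cong (e f) (e f)) (P.*-cong (e g) (e g)) ⟩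
    _ ≈⟨ P.*-cong (e′ f) (e′ g) ⟨
    _ ≈⟨ P.*-identityˡ _ ⟨
    _ ≈⟨ P.*-congʳ (P.+-identityʳ _) ⟨
    _ ∎)
    where
    e : ∀ f → characterSum {zero} f [] ≋ f []
    e f = P.trans (P.+-identityʳ _) (P.*-identityˡ _)
    e′ : ∀ f → weight {zero} f ≋ f [] ⊗ f []
    e′ f = P.trans (P.+-identityʳ _) (P.+-identityʳ _)
  hypercontractive {suc n} f g df dg =
    ≼-trans (≋⇒≼ (P.trans (L.∑-allVecs Sign.+ Sign.- n _) (P.sym (L.∑-+ xs _ _))))
    (≼-trans (∑-mono xs pointwise)
    (≼-trans (≋⇒≼ (P.trans (L.∑-· xs 2 _) (×-congʳ 2 (P.trans (L.∑-+ xs _ _)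
        (P.+-cong (L.∑-+ xs _ _) (P.trans (L.∑-· xs 3 _) (×-congʳ 3 (L.∑-+ xs _ _))))))))
    -- All four pairs of halves are needed; the mixed pairs are the reason for two functions in the
    -- induction hypothesis.
    (≼-trans (·-mono 2 (⊕-mono
        (⊕-mono (hypercontractive f₀ g₀ df₀ dg₀) (hypercontractive f₁ g₁ df₁ dg₁))
        (·-mono 3 (⊕-mono (hypercontractive f₀ g₁ df₀ dg₁) (hypercontractive f₁ g₀ df₁ dg₀)))))
    -- This surplus raises the coefficient of `weight f₁ ⊗ weight g₁` from 1 to 9, completing the
    -- product of the two weights.
    (≼-trans (≼-add (SOS-· 4 (SOS-· 4
        (SOS-⊗ (SOS-ℕ (2 ^ n)) (SOS-⊗ (weight-SOS df₁) (weight-SOS dg₁))))))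
    (≋⇒≼ (P.trans (L.weight-product _ _ _ _ _)
      (P.*-cong (×-assocˡ _ 2 (2 ^ n))
                (P.*-cong (P.sym (weight-∷ f)) (P.sym (weight-∷ g))))))))))
    where
    xs = allVecs signs n
    f₀ f₁ g₀ g₁ : Subset n → Poly
    f₀ = f ∘ (outside ∷_)
    f₁ = f ∘ (inside ∷_)
    g₀ = g ∘ (outside ∷_)
    g₁ = g ∘ (inside ∷_)
    df₀ : ∀ α → Degree≤ 1 (f₀ α)
    df₀ α = df (outside ∷ α)
    df₁ : ∀ α → Degree≤ 1 (f₁ α)
    df₁ α = df (inside ∷ α)
    dg₀ : ∀ α → Degree≤ 1 (g₀ α)
    dg₀ α = dg (outside ∷ α)
    dg₁ : ∀ α → Degree≤ 1 (g₁ α)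
    dg₁ α = dg (inside ∷ α)
    sq : Poly → Poly
    sq p = p ⊗ p
    pointwise : ∀ x →
      let F₀ = characterSum f₀ x ; F₁ = characterSum f₁ x
          G₀ = characterSum g₀ x ; G₁ = characterSum g₁ x in
      sq (characterSum f (Sign.+ ∷ x)) ⊗ sq (characterSum g (Sign.+ ∷ x)) ⊕
      sq (characterSum f (Sign.- ∷ x)) ⊗ sq (characterSum g (Sign.- ∷ x)) ≼[ 2 ]
      2 · ((sq F₀ ⊗ sq G₀ ⊕ sq F₁ ⊗ sq G₁) ⊕ 3 · (sq F₀ ⊗ sq G₁ ⊕ sq F₁ ⊗ sq G₀))
    -- The slack is the square of 2(F₀G₁ - F₁G₀), which has degree at most 2 because `f` and `g`
    -- have degree at most 1.
    pointwise x = _ , square (⊕-deg h-deg h-deg) ,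
      P.trans (P.+-congʳ (P.+-cong
          (P.*-cong (P.*-cong (plus-∷ f) (plus-∷ f)) (P.*-cong (plus-∷ g) (plus-∷ g)))
          (P.*-cong (P.*-cong (minus-∷ f) (minus-∷ f)) (P.*-cong (minus-∷ g) (minus-∷ g)))))
        (L.two-point 1+-1≋0 _ _ _ _)
      where
      plus-∷ : ∀ f → characterSum f (Sign.+ ∷ x) ≋
                     characterSum (f ∘ (outside ∷_)) x ⊕ characterSum (f ∘ (inside ∷_)) x
      plus-∷ f = P.trans (characterSum-∷ f Sign.+ x) (P.+-congˡ (P.*-identityˡ _))
      minus-∷ : ∀ f → characterSum f (Sign.- ∷ x) ≋
                      characterSum (f ∘ (outside ∷_)) x ⊕ -1ᴾ ⊗ characterSum (f ∘ (inside ∷_)) x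
      minus-∷ f = characterSum-∷ f Sign.- x
      h-deg : Degree≤ 2 (characterSum f₀ x ⊗ characterSum g₁ x ⊕
                         -1ᴾ ⊗ (characterSum f₁ x ⊗ characterSum g₀ x))
      h-deg = ⊕-deg (⊗-deg (characterSum-degree df₀ x) (characterSum-degree dg₁ x))
                    (⊗-deg (con-deg _)
                      (⊗-deg (characterSum-degree df₁ x) (characterSum-degree dg₀ x)))

  -- Truncation to low degree.

  -- High coefficients are set to zero instead of filtering the index list, so that the induction
  -- over all subsets applies.
  lowDegree : ∀ {n} → ℕ → (Subset n → Poly) → Subset n → Poly
  lowDegree d f α = if does (∣ α ∣ ℕₚ.≤? d) then f α else con 0#

  lowDegree-degree : ∀ {k n} d {f : Subset n → Poly} → (∀ α → Degree≤ k (f α)) →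
                     ∀ α → Degree≤ k (lowDegree d f α)
  lowDegree-degree d df α with does (∣ α ∣ ℕₚ.≤? d)
  ... | true  = df α
  ... | false = ≤-deg z≤n (con-deg 0#)

  -- A kept term has 3^|α| ≤ 3^d; a discarded term is zero and lies below any natural multiple of a
  -- square.
  weight-lowDegree : ∀ {k n} d {f : Subset n → Poly} → (∀ α → Degree≤ k (f α)) →
    weight (lowDegree d f) ≼[ k ] (3 ^ d) · ∑ᴾ (allSubsets n) (λ α → f α ⊗ f α)
  weight-lowDegree {k} {n} d {f} df =
    ≼-trans (∑-mono (allSubsets n) (λ α → termwise α (∣ α ∣ ℕₚ.≤? d)))
            (≋⇒≼ (L.∑-· (allSubsets n) (3 ^ d) _))
    where
    -- The decision is an argument, so that matching on it both reduces the conditional and exposes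
    -- the proof of |α| ≤ d.
    termwise : ∀ α (α≤?d : Dec (∣ α ∣ ≤ d)) → let p = if does α≤?d then f α else con 0# in
               (3 ^ ∣ α ∣) · (p ⊗ p) ≼[ k ] (3 ^ d) · (f α ⊗ f α)
    termwise α (yes α≤d) = ·-monoˡ (ℕₚ.^-monoʳ-≤ 3 α≤d) (square (df α))
    termwise α (no  _)   = _ , SOS-· (3 ^ d) (square (df α)) , P.trans (P.+-congʳ (begin
      (3 ^ ∣ α ∣) · (con 0# ⊗ con 0#) ≈⟨ ×-congʳ (3 ^ ∣ α ∣) (P.zeroˡ _) ⟩
      (3 ^ ∣ α ∣) · con 0#            ≈⟨ L.·-* (3 ^ ∣ α ∣) _ ⟩
      _ ⊗ con 0#                      ≈⟨ P.zeroʳ _ ⟩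
      con 0#                          ∎)) (P.+-identityˡ _)

-- Order arithmetic without decidability.

module OrderedField {c ℓ₁ ℓ₂} (ℝ : Reals c ℓ₁ ℓ₂) where
  open Reals ℝ renaming (_≤_ to _≤ᴿ_)
  open CommutativeRing commutativeRing
    hiding (_≈_; _+_; _*_; -_; 0#; 1#; Carrier; isCommutativeRing)
  open SemiringMult semiring renaming (_×_ to _·_) using ()
  private module < = IsStrictPartialOrder isStrictPartialOrder

  -- Cotransitivity of `#` compares `y` with `x` or with `z`; the two unwanted directions are
  -- repaired by transitivity through x < z. This replaces trichotomy in proving transitivity of
  -- `≤`, a negated `<`.
  <-cotrans : ∀ {x z} → x < z → ∀ y → x < y ⊎ y < z
  <-cotrans x<z y with IsHeytingField.#-cotrans isHeytingField (inj₁ x<z) y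
  ... | inj₁ (inj₁ x<y) = inj₁ x<y
  ... | inj₁ (inj₂ y<x) = inj₂ (<.trans y<x x<z)
  ... | inj₂ (inj₁ y<z) = inj₂ y<z
  ... | inj₂ (inj₂ z<y) = inj₁ (<.trans x<z z<y)

  ≤-reflexive : ∀ {x y} → x ≈ y → x ≤ᴿ y
  ≤-reflexive x≈y y<x = <.irrefl (sym x≈y) y<x

  ≤-trans : ∀ {x y z} → x ≤ᴿ y → y ≤ᴿ z → x ≤ᴿ z
  ≤-trans {y = y} x≤y y≤z z<x with <-cotrans z<x y
  ... | inj₁ z<y = y≤z z<y
  ... | inj₂ y<x = x≤y y<x

  +-monoˡ-≤ : ∀ {x y} z → x ≤ᴿ y → x + z ≤ᴿ y + z
  +-monoˡ-≤ z x≤y y+z<x+z =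
    x≤y (<.<-respˡ-≈ (cancel _) (<.<-respʳ-≈ (cancel _) (+-monoˡ-< (- z) y+z<x+z)))
    where
    cancel : ∀ x → (x + z) + - z ≈ x
    cancel x = trans (+-assoc x z _) (trans (+-congˡ (-‿inverseʳ z)) (+-identityʳ x))

  +-monoʳ-≤ : ∀ {x y} z → x ≤ᴿ y → z + x ≤ᴿ z + y
  +-monoʳ-≤ z x≤y = ≤-trans (≤-reflexive (+-comm z _))
    (≤-trans (+-monoˡ-≤ z x≤y) (≤-reflexive (+-comm _ z)))

  +-mono-≤ : ∀ {x y u v} → x ≤ᴿ y → u ≤ᴿ v → x + u ≤ᴿ y + v
  +-mono-≤ x≤y u≤v = ≤-trans (+-monoˡ-≤ _ x≤y) (+-monoʳ-≤ _ u≤v)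

  ·-mono-≤ : ∀ n {x y} → x ≤ᴿ y → n · x ≤ᴿ n · y
  ·-mono-≤ zero    x≤y = ≤-reflexive refl
  ·-mono-≤ (suc n) x≤y = +-mono-≤ x≤y (·-mono-≤ n x≤y)

-- Level-4 pseudo-expectations and their monotonicity.

module PseudoExpectations {c ℓ₁ ℓ₂} (ℝ : Reals c ℓ₁ ℓ₂) {U : FiniteSet}
                          (Ẽ : OverReals.PseudoExpectation ℝ U 4) where
  open Reals ℝ renaming (_≤_ to _≤ᴿ_)
  open CommutativeRing commutativeRing
    hiding (_≈_; _+_; _*_; -_; 0#; 1#; Carrier; isCommutativeRing)
  open SemiringMult semiring renaming (_×_ to _·_) using ()
  open OrderedField ℝ
  open OverReals.PseudoExpectation Ẽ
  open Polynomials commutativeRing (FiniteSet.Element U) renaming (_^_ to _^ᴾ_)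
  open SumsOfSquares commutativeRing (FiniteSet.Element U)
  private
    module P = CommutativeRing polyRing
    module L = RingLemmas polyRing
  open SemiringMult P.semiring renaming (_×_ to _·ᴾ_) using ()
  open Hypercontractivity ℝ (FiniteSet.Element U) using (1+-1≋0)
  open SetoidReasoning setoid

  ·-degree : ∀ {k p} n → Degree≤ k p → Degree≤ k (n ·ᴾ p)
  ·-degree zero    d = ≤-deg z≤n (con-deg 0#)
  ·-degree (suc n) d = ⊕-deg d (·-degree n d)

  E-0 : ∀ d → E (con 0#) d ≈ 0#
  E-0 d = begin
    E (con 0#) d         ≈⟨ E-cong d d′ (P.sym (P.zeroˡ _)) ⟩
    E (con 0# ⊗ con 1#) d′ ≈⟨ E-* 0# d₁ d′ ⟩
    0# * E (con 1#) d₁   ≈⟨ zeroˡ _ ⟩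
    0#                   ∎
    where
    d₁ : Degree≤ 4 (con 1#)
    d₁ = ≤-deg z≤n (con-deg 1#)
    d′ = ≋-deg (P.sym (P.zeroˡ _)) d

  E-· : ∀ n {p} (dp : Degree≤ 4 p) d → E (n ·ᴾ p) d ≈ n · E p dp
  E-· zero    dp d = E-0 d
  E-· (suc n) dp d = trans (E-+ dp (·-degree n dp) d) (+-congˡ (E-· n dp _))

  E-square : ∀ {p} → Degree≤ 2 p → ∀ d → 0# ≤ᴿ E (p ⊗ p) d
  E-square {p} dp d = ≤-trans (E-sq dp (ℕₚ.≤-refl {4}) d′) (≤-reflexive (E-cong d′ d (P.sym e)))
    where
    e : p ⊗ p ≋ p ^ᴾ 2
    e = P.*-congˡ (P.sym (P.*-identityʳ p))
    d′ = ≋-deg e d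

  -- Each summand of a certificate has degree at most 4 on its own by `SOS-degree`, so `E` is
  -- defined on it and additivity applies.
  E-SOS : ∀ {p} → SOS 2 p → ∀ d → 0# ≤ᴿ E p d
  E-SOS zero       d = ≤-reflexive (sym (E-0 d))
  E-SOS (square s) d = E-square s d
  E-SOS (plus s t) d = ≤-trans (≤-reflexive (sym (+-identityˡ 0#)))
    (≤-trans (+-mono-≤ (E-SOS s (SOS-degree s)) (E-SOS t (SOS-degree t)))
             (≤-reflexive (sym (E-+ _ _ d))))
  E-SOS (resp e s) d = ≤-trans (E-SOS s (SOS-degree s)) (≤-reflexive (E-cong _ d e))

  E-mono : ∀ {p q} → p ≼[ 2 ] q → ∀ dp dq → E p dp ≤ᴿ E q dq
  E-mono (s , sos , e) dp dq =
    ≤-trans (≤-reflexive (sym (+-identityʳ _)))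
      (≤-trans (+-monoʳ-≤ _ (E-SOS sos ds))
        (≤-reflexive (trans (sym (E-+ dp ds dps)) (E-cong dps dq e))))
    where
    ds  = SOS-degree sos
    dps = ⊕-deg dp ds

  -- If e = Ẽ q were positive, Ẽ (e − q)² = e² − 2e² would be negative.
  E-null-square : ∀ {q} → Degree≤ 2 q → ∀ dq dqq → E (q ⊗ q) dqq ≈ 0# → E q dq ≤ᴿ 0#
  E-null-square {q} d₂ dq dqq Eqq≈0 0<e = ≤-trans
    -- With p = e - q this chain reads e² ≤ Ẽ p² + e² = 0, against e² > 0.
    (≤-trans (≤-reflexive (sym (+-identityˡ _))) (+-monoˡ-≤ (e * e) (E-square dp dpp)))
    (≤-reflexive total) (*-pos 0<e 0<e)
    where
    e = E q dq
    p = con e ⊕ con (- 1#) ⊗ q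
    dp : Degree≤ 2 p
    dp = ⊕-deg (≤-deg z≤n (con-deg e)) (⊗-deg (con-deg _) d₂)
    dpp : Degree≤ 4 (p ⊗ p)
    dpp = ⊗-deg dp dp
    d₁ : Degree≤ 4 (con 1#)
    d₁ = ≤-deg z≤n (con-deg 1#)
    dqs = ⊕-deg dq dq
    dl : Degree≤ 4 (p ⊗ p ⊕ con e ⊗ (q ⊕ q))
    dl = ⊕-deg dpp (⊗-deg (con-deg e) dqs)
    -- The constant e² is written as a multiple of `con 1#`, the form that `E-*` and `E-1` evaluate.
    dr : Degree≤ 4 (con (e * e) ⊗ con 1# ⊕ q ⊗ q)
    dr = ⊕-deg (≤-deg z≤n (⊗-deg (con-deg _) (con-deg _))) dqq
    identity : p ⊗ p ⊕ con e ⊗ (q ⊕ q) ≋ con (e * e) ⊗ con 1# ⊕ q ⊗ q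
    identity = P.trans (L.square-of-difference 1+-1≋0 (con e) q)
      (P.+-congʳ (P.trans (P.sym (con-* e e)) (P.sym (P.*-identityʳ _))))
    -- Applying Ẽ to p² + 2eq = e² + q², with Ẽ q = e and Ẽ q² = 0, gives Ẽ p² + 2e² = e².
    balance : (E (p ⊗ p) dpp + e * e) + e * e ≈ e * e
    balance = begin
      (E (p ⊗ p) dpp + e * e) + e * e     ≈⟨ +-assoc _ _ _ ⟩
      E (p ⊗ p) dpp + (e * e + e * e)     ≈⟨ +-congˡ (distribˡ e e e) ⟨
      E (p ⊗ p) dpp + e * (e + e)         ≈⟨ +-congˡ (*-congˡ (E-+ dq dq dqs)) ⟨
      E (p ⊗ p) dpp + e * E (q ⊕ q) dqs   ≈⟨ +-congˡ (E-* e dqs (⊗-deg (con-deg e) dqs)) ⟨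
      E (p ⊗ p) dpp + E (con e ⊗ (q ⊕ q)) _  ≈⟨ E-+ _ _ dl ⟨
      E _ dl                              ≈⟨ E-cong dl dr identity ⟩
      E _ dr                              ≈⟨ E-+ _ dqq dr ⟩
      E (con (e * e) ⊗ con 1#) _ + E (q ⊗ q) dqq
        ≈⟨ +-cong (E-* (e * e) d₁ (≤-deg z≤n (⊗-deg (con-deg _) (con-deg _)))) Eqq≈0 ⟩
      (e * e) * E (con 1#) d₁ + 0#        ≈⟨ +-identityʳ _ ⟩
      (e * e) * E (con 1#) d₁             ≈⟨ *-congˡ (E-1 d₁) ⟩
      (e * e) * 1#                        ≈⟨ *-identityʳ _ ⟩
      e * e                               ∎
    total : E (p ⊗ p) dpp + e * e ≈ 0#
    total = RingProperties.+-cancelʳ ring (e * e) _ _ (trans balance (sym (+-identityˡ _)))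

  -- In m² = q² + 2q + 1 the first term vanishes under `E`, and the second is nonpositive by
  -- `E-null-square`.
  E-normalised : ∀ {m q} → q ⊕ con 1# ≋ m → Degree≤ 2 q → ∀ dqq dmm →
                 E (q ⊗ q) dqq ≈ 0# → E (m ⊗ m) dmm ≤ᴿ 1#
  E-normalised {m} {q} e d₂ dqq dmm Eqq≈0 = ≤-trans (≤-reflexive expand)
    (≤-trans (+-monoˡ-≤ 1# (+-mono-≤ Eq≤0 Eq≤0))
      (≤-reflexive (trans (+-congʳ (+-identityʳ 0#)) (+-identityˡ 1#))))
    where
    dq : Degree≤ 4 q
    dq = ≤-deg (s≤s (s≤s z≤n)) d₂
    Eq≤0 = E-null-square d₂ dq dqq Eqq≈0
    d₁ : Degree≤ 4 (con 1#)
    d₁ = ≤-deg z≤n (con-deg 1#)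
    dqs = ⊕-deg dq dq
    dqs1 = ⊕-deg dqs d₁
    dr = ⊕-deg dqq dqs1
    open NaturalSolver P.commutativeSemiring using (solve; _:=_; _:+_; _:*_) renaming (con to :con)
    identity : m ⊗ m ≋ q ⊗ q ⊕ ((q ⊕ q) ⊕ con 1#)
    identity = P.trans (P.sym (P.*-cong e e))
      (solve 1 (λ q → (q :+ :con 1) :* (q :+ :con 1) := q :* q :+ ((q :+ q) :+ :con 1)) P.refl q)
    expand : E (m ⊗ m) dmm ≈ (E q dq + E q dq) + 1#
    expand = begin
      E (m ⊗ m) dmm                           ≈⟨ E-cong dmm dr identity ⟩
      E _ dr                                  ≈⟨ E-+ dqq dqs1 dr ⟩
      E (q ⊗ q) dqq + E _ dqs1                ≈⟨ +-cong Eqq≈0 (E-+ dqs d₁ dqs1) ⟩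
      0# + (E (q ⊕ q) dqs + E (con 1#) d₁)    ≈⟨ +-identityˡ _ ⟩
      E (q ⊕ q) dqs + E (con 1#) d₁           ≈⟨ +-cong (E-+ dq dq dqs) (E-1 d₁) ⟩
      (E q dq + E q dq) + 1#                  ∎

-- The bound for the low-degree projection.

module LowDegreeProjection {c ℓ₁ ℓ₂} (ℝ : Reals c ℓ₁ ℓ₂) (n d : ℕ) where
  open Reals ℝ renaming (_≤_ to _≤ᴿ_)
  open OverReals ℝ
  open Polynomials commutativeRing (Vec Sign n) renaming (_^_ to _^ᴾ_)
  open SumsOfSquares commutativeRing (Vec Sign n)
  open Hypercontractivity ℝ (Vec Sign n)
  private
    module R = CommutativeRing commutativeRing
    module P = CommutativeRing polyRing
    module LR = RingLemmas commutativeRing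
    module LP = RingLemmas polyRing
  open SemiringMult P.semiring using (×-congʳ; ×-assocˡ; ×-comm-*; ×-assoc-*) renaming (_×_ to _·_)
  open NaturalSolver P.commutativeSemiring using (solve; _:=_; _:*_) renaming (con to :con)
  open SetoidReasoning P.setoid

  points : List (Vec Sign n)
  points = allVecs signs n

  r : Carrier
  r = recipCard (cube n)

  con-∑ : ∀ {I : Set} (is : List I) (g : I → Carrier) → con (∑ is g) ≋ ∑ᴾ is (con ∘ g)
  con-∑ []       g = P.refl
  con-∑ (i ∷ is) g = P.trans (con-+ _ _) (P.+-congˡ (con-∑ is g))

  con-fromℕ : ∀ m → con (fromℕ m) ≋ m · con 1#
  con-fromℕ zero    = P.refl
  con-fromℕ (suc m) = P.trans (con-+ _ _) (P.+-congˡ (con-fromℕ m))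

  r-inverse : con r ⊗ ((2 ^ n) · con 1#) ≋ con 1#
  r-inverse = begin
    con r ⊗ ((2 ^ n) · con 1#)            ≈⟨ P.*-congˡ (con-fromℕ (2 ^ n)) ⟨
    con r ⊗ con (fromℕ (2 ^ n))
      ≡⟨ ≡.cong (λ m → con r ⊗ con (fromℕ m)) (length-allVecs Sign.+ Sign.- n) ⟨
    con r ⊗ con (fromℕ (length points))   ≈⟨ con-* _ _ ⟨
    con (r * fromℕ (length points))
      ≈⟨ con-cong (recip-inverse (length points) {{FiniteSet.nonEmpty (cube n)}}) ⟩
    con 1#                                ∎

  -- r = 2ⁿ r² is a sum of squares of constants.
  r-SOS : SOS 0 (con r)
  r-SOS = resp (begin
    ((2 ^ n) · con 1#) ⊗ (con r ⊗ con r)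
      ≈⟨ solve 2 (λ N r → N :* (r :* r) := (r :* N) :* r) P.refl _ _ ⟩
    (con r ⊗ ((2 ^ n) · con 1#)) ⊗ con r  ≈⟨ P.*-congʳ r-inverse ⟩
    con 1# ⊗ con r                        ≈⟨ P.*-identityˡ _ ⟩
    con r                                 ∎)
    (SOS-⊗ (SOS-ℕ (2 ^ n)) (square (con-deg r)))

  δ-diagonal : ∀ (U : FiniteSet) u → δ U u u ≈ 1#
  δ-diagonal U u with FiniteSet._≟_ U u u
  ... | yes _   = R.refl
  ... | no  u≢u = contradiction ≡.refl u≢u

  δ-off-diagonal : ∀ (U : FiniteSet) {u v} → u ≢ v → δ U u v ≈ 0#
  δ-off-diagonal U {u} {v} u≢v with FiniteSet._≟_ U u v
  ... | yes u≡v = contradiction u≡v u≢v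
  ... | no  _   = R.refl

  -- Only the term at `u` survives in the average. `Af` is built from images of point masses, so
  -- these coefficients determine its matrix entries.
  fourier-δ : ∀ u (α : Subset n) → fourier (δ (cube n) u) α ≈ r * χ α u
  fourier-δ u α = R.*-congˡ (R.trans
    (LR.∑-single (FiniteSet.unique (cube n)) (FiniteSet.complete (cube n) u)
      (λ u≢x → R.trans (R.*-congʳ (δ-off-diagonal (cube n) u≢x)) (R.zeroˡ _)))
    (R.trans (R.*-congʳ (δ-diagonal (cube n) u)) (R.*-identityˡ _)))

  -- The Fourier coefficient of the indeterminate function, as a linear form in its values.
  f̂ : Subset n → Poly
  f̂ α = con r ⊗ transform var α

  f̂-degree : ∀ α → Degree≤ 1 (f̂ α)
  f̂-degree α = ⊗-deg (con-deg r) (transform-degree var-deg α)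

  M : Poly
  M = ‖f‖₂² (cube n)

  -- Of the two factors `r` from normalisation, one cancels the 2ⁿ of `parseval` and the other turns
  -- the sum over points into the average `M`.
  parseval-f̂ : ∑ᴾ (allSubsets n) (λ α → f̂ α ⊗ f̂ α) ≋ M
  parseval-f̂ = begin
    ∑ᴾ (allSubsets n) (λ α → f̂ α ⊗ f̂ α)
      ≈⟨ LP.∑-cong (allSubsets n) (λ α →
           solve 2 (λ r t → (r :* t) :* (r :* t) := (r :* r) :* (t :* t)) P.refl _ _) ⟩
    _ ≈⟨ LP.∑-* (allSubsets n) _ _ ⟩
    (con r ⊗ con r) ⊗ ∑ᴾ (allSubsets n) (λ α → transform var α ⊗ transform var α)
      ≈⟨ P.*-congˡ (P.trans (parseval var) (LP.·-* (2 ^ n) _)) ⟩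
    (con r ⊗ con r) ⊗ (((2 ^ n) · con 1#) ⊗ ∑ᴾ points (λ u → var u ⊗ var u))
      ≈⟨ solve 3 (λ r N s → (r :* r) :* (N :* s) := (r :* N) :* (r :* s)) P.refl _ _ _ ⟩
    (con r ⊗ ((2 ^ n) · con 1#)) ⊗ (con r ⊗ ∑ᴾ points (λ u → var u ⊗ var u))
      ≈⟨ P.trans (P.*-congʳ r-inverse) (P.*-identityˡ _) ⟩
    con r ⊗ ∑ᴾ points (λ u → var u ⊗ var u)
      ≈⟨ P.*-congˡ (LP.∑-cong points (λ u → P.*-congˡ (P.*-identityʳ _))) ⟨
    M ∎

  low : List (Subset n)
  low = lowSubsets n d

  𝒫f : Vec Sign n → Poly
  𝒫f = Af (cube n) (𝒫 n d)

  -- Exchanging the sum over points with the sum over low sets collects `f̂ α` as the coefficient of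
  -- each character.
  𝒫f≋characterSum : ∀ x → 𝒫f x ≋ characterSum (lowDegree d f̂) x
  𝒫f≋characterSum x = begin
    ∑ᴾ points (λ u → con (∑ low (λ α → fourier (δ (cube n) u) α * χ α x)) ⊗ var u)
      ≈⟨ LP.∑-cong points (λ u → P.trans (P.*-congʳ (con-∑ low _)) (P.sym (LP.∑-*ʳ low _ _))) ⟩
    ∑ᴾ points (λ u → ∑ᴾ low (λ α → con (fourier (δ (cube n) u) α * χ α x) ⊗ var u))
      ≈⟨ LP.∑-cong points (λ u → LP.∑-cong low (λ α → coefficient u α)) ⟩
    ∑ᴾ points (λ u → ∑ᴾ low (λ α → con (χ α x) ⊗ (con r ⊗ (con (χ α u) ⊗ var u))))
      ≈⟨ LP.∑-swap points low _ ⟩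
    ∑ᴾ low (λ α → ∑ᴾ points (λ u → con (χ α x) ⊗ (con r ⊗ (con (χ α u) ⊗ var u))))
      ≈⟨ LP.∑-cong low (λ α → P.trans (LP.∑-* points _ _) (P.*-congˡ (LP.∑-* points _ _))) ⟩
    ∑ᴾ low (λ α → con (χ α x) ⊗ f̂ α)
      ≈⟨ LP.∑-filter (λ α → ∣ α ∣ ℕₚ.≤? d) (allSubsets n) _ ⟩
    ∑ᴾ (allSubsets n) (λ α → if does (∣ α ∣ ℕₚ.≤? d) then con (χ α x) ⊗ f̂ α else con 0#)
      ≈⟨ LP.∑-cong (allSubsets n) (λ α → ⊗-if (does (∣ α ∣ ℕₚ.≤? d))) ⟩
    characterSum (lowDegree d f̂) x ∎
    where
    coefficient : ∀ u α → con (fourier (δ (cube n) u) α * χ α x) ⊗ var u ≋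
                          con (χ α x) ⊗ (con r ⊗ (con (χ α u) ⊗ var u))
    coefficient u α = begin
      con (fourier (δ (cube n) u) α * χ α x) ⊗ var u
        ≈⟨ P.*-congʳ (P.trans (con-cong (R.*-congʳ (fourier-δ u α)))
                              (P.trans (con-* _ _) (P.*-congʳ (con-* _ _)))) ⟩
      ((con r ⊗ con (χ α u)) ⊗ con (χ α x)) ⊗ var u
        ≈⟨ solve 4 (λ r a b v → ((r :* a) :* b) :* v := b :* (r :* (a :* v))) P.refl _ _ _ _ ⟩
      con (χ α x) ⊗ (con r ⊗ (con (χ α u) ⊗ var u)) ∎
    ⊗-if : ∀ b {p q} → (if b then p ⊗ q else con 0#) ≋ p ⊗ (if b then q else con 0#)
    ⊗-if true  = P.refl
    ⊗-if false = P.sym (P.zeroʳ _)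

  3^d*3^d≡9^d : 3 ^ d ℕ.* 3 ^ d ≡ 9 ^ d
  3^d*3^d≡9^d = ≡.trans (≡.sym (ℕₚ.^-distribˡ-+-* 3 d d))
    (≡.trans (≡.cong (λ e → 3 ^ (d ℕ.+ e)) (≡.sym (ℕₚ.+-identityʳ d)))
      (≡.sym (ℕₚ.^-*-assoc 3 2 d)))

  ‖𝒫f‖₄⁴≼9^dM² : ‖Af‖₄⁴ (cube n) (𝒫 n d) ≼[ 2 ] (9 ^ d) · (M ⊗ M)
  ‖𝒫f‖₄⁴≼9^dM² =
    ≼-trans (≋⇒≼ (P.*-congˡ (LP.∑-cong points fourth-power)))
    -- Multiplying by the averaging factor `r` preserves the certificate and its degree, as `r` lies
    -- in `SOS 0`; `r` then cancels the 2ⁿ on the right.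
    (≼-trans (⊗-monoʳ r-SOS (hypercontractive g g g-degree g-degree))
    (≼-trans (≋⇒≼ (P.trans (P.sym (P.*-assoc _ _ _))
                           (P.trans (P.*-congʳ r-inverse) (P.*-identityˡ _))))
    -- The weight bound has certificate degree 1, so squaring it stays within degree 2.
    (≼-trans (squares-mono (weight-SOS g-degree) (weight-lowDegree d f̂-degree))
    (≋⇒≼ (begin
      _ ≈⟨ P.*-cong (×-congʳ (3 ^ d) parseval-f̂) (×-congʳ (3 ^ d) parseval-f̂) ⟩
      (3 ^ d) · M ⊗ (3 ^ d) · M      ≈⟨ ×-assoc-* (3 ^ d) _ _ ⟩
      (3 ^ d) · (M ⊗ (3 ^ d) · M)    ≈⟨ ×-congʳ (3 ^ d) (×-comm-* (3 ^ d) _ _) ⟩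
      (3 ^ d) · (3 ^ d) · (M ⊗ M)    ≈⟨ ×-assocˡ _ (3 ^ d) (3 ^ d) ⟩
      (3 ^ d ℕ.* 3 ^ d) · (M ⊗ M)    ≡⟨ ≡.cong (_· (M ⊗ M)) 3^d*3^d≡9^d ⟩
      (9 ^ d) · (M ⊗ M)              ∎)))))
    where
    g = lowDegree d f̂
    g-degree = lowDegree-degree d f̂-degree
    fourth-power : ∀ x → 𝒫f x ^ᴾ 4 ≋ (characterSum g x ⊗ characterSum g x) ⊗
                                      (characterSum g x ⊗ characterSum g x)
    fourth-power x = P.trans
      (solve 1 (λ p → p :* (p :* (p :* (p :* :con 1))) := (p :* p) :* (p :* p)) P.refl (𝒫f x))
      (P.*-cong (P.*-cong e e) (P.*-cong e e))
      where e = 𝒫f≋characterSum x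

  tensorSDP-bound : TensorSDP≤ (𝒫 n d) (fromℕ (9 ^ d))
  tensorSDP-bound Ẽ E-sphere≈0 =
    -- Ẽ is applied to the certificate, leaving 9^d Ẽ M²; the sphere constraint, read as Ẽ (M - 1)²
    -- = 0, bounds Ẽ M² by 1.
    ≤-trans (E-mono ‖𝒫f‖₄⁴≼9^dM² _ (·-degree (9 ^ d) M²-degree))
      (≤-trans (≤-reflexive (E-· (9 ^ d) M²-degree _))
        (·-mono-≤ (9 ^ d) (E-normalised M-1+1≋M q-degree q²-degree M²-degree
          (R.trans (E-cong _ _ q²≋sphere) E-sphere≈0))))
    where
    open OrderedField ℝ
    open OverReals.PseudoExpectation Ẽ using (E-cong)
    open PseudoExpectations ℝ Ẽ
    q = M ⊕ ⊝ con 1#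
    M-degree : Degree≤ 2 M
    M-degree = 𝔼ᴾ-deg (cube n) (cube n) (λ u → ^-deg (var-deg u) 2)
    M²-degree : Degree≤ 4 (M ⊗ M)
    M²-degree = ⊗-deg M-degree M-degree
    q-degree : Degree≤ 2 q
    q-degree = ⊕-deg M-degree (≤-deg z≤n (⊗-deg (con-deg _) (con-deg _)))
    q²≋sphere : q ⊗ q ≋ sphere (cube n)
    q²≋sphere = P.*-congˡ (P.sym (P.*-identityʳ _))
    q²-degree : Degree≤ 4 (q ⊗ q)
    q²-degree = ≋-deg (P.sym q²≋sphere) (sphere-deg (cube n))
    M-1+1≋M : q ⊕ con 1# ≋ M
    M-1+1≋M = P.trans (P.+-assoc _ _ _) (P.trans (P.+-congˡ (P.-‿inverseˡ _)) (P.+-identityʳ M))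

theorem2p2 : ∀ {c ℓ₁ ℓ₂} (ℝ : Reals c ℓ₁ ℓ₂) (d n : ℕ) → d ≤ n →
    OverReals.TensorSDP≤ ℝ (OverReals.𝒫 ℝ n d) (Reals.fromℕ ℝ (9 ^ d))
theorem2p2 ℝ d n _ = LowDegreeProjection.tensorSDP-bound ℝ n d
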